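{- Let $G$ be a graph. \begin{itemize} \item If $G$ does not contain $P_3$ as a subgraph, then $o(G)=\mathcal{A}$. \item If $G$ contains $2P_3$, $C_4$ or the 3-sunlet as a subgraph, then $o(G)=\mathcal{E}$. \item In all other cases, $o(G)=\mathcal{SL}$. \end{itemize}
   Context: Graphs are finite simple graphs, viewed as 2-uniform hypergraphs (every edge has exactly 2 vertices). In the Avoider-Enforcer game on $G$, two players, Avoider and Enforcer, alternately pick one previously unpicked vertex of $G$ until all vertices have been picked. Enforcer wins if at the end Avoider has picked all the vertices of some edge of $G$; otherwise Avoider wins. The last player is the player who makes the last move of the game: this is the first player if $|V(G)|$ is odd and the second player if $|V(G)|$ is even; the other player is the second-to-last player. A player "wins as last (resp. second-to-last) player" if that player has a winning strategy when they are the last (resp. second-to-last) player. The outcome $o(G)$ is: $\mathcal{A}$ if Avoider wins both as last player and as second-to-last player; $\mathcal{E}$ if Enforcer wins both as last player and as second-to-last player; $\mathcal{SL}$ if whichever player is second-to-last wins. These are the only three possibilities. $P_n$ and $C_n$ denote the path and the cycle on $n$ vertices. $2P_3$ is the disjoint union of two copies of $P_3$. The 3-sunlet is the graph obtained from $C_3$ by attaching a pendent edge (to a new vertex) to each of its three vertices (so it has 6 vertices). Subgraphs are not necessarily induced. -}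

module Defs where

open import Data.Bool using (true; false; if_then_else_)
open import Data.Empty using (⊥)
open import Data.Fin using (Fin; toℕ)
open import Data.Maybe using (Maybe; just; nothing)
open import Data.Nat using (ℕ; suc; _+_; _%_; _≡ᵇ_)
open import Data.Nat.Properties using (1+n≢n)
import Data.Nat.Properties as ℕ
import Data.Fin.Properties as Fin
open import Data.Product using (∃; ∃-syntax; _×_; _,_)
open import Data.Sum using (_⊎_; inj₁; inj₂; swap)
open import Data.Vec using (Vec; lookup; replicate; _[_]≔_)
open import Function.Definitions using (Injective)
open import Level using (0ℓ)
open import Relation.Binary.Core using (Rel)
open import Relation.Binary.Definitions using (Decidable; Symmetric; Irreflexive)
open import Relation.Binary.PropositionalEquality using (_≡_; _≢_; refl; sym; trans; cong)
open import Relation.Nullary using (¬_; no; _×-dec_; _⊎-dec_)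

-- Simple graphs on a vertex type V.  Finite graphs are those with V = Fin n;
-- the small pattern graphs below also use finite sums of such types.
record Graph (V : Set) : Set₁ where
  field
    Adj    : Rel V 0ℓ
    adj?   : Decidable Adj
    symm   : Symmetric Adj
    irrefl : Irreflexive _≡_ Adj

open Graph public

-- H ⊑ G : G has a (not necessarily induced) subgraph isomorphic to H.
_⊑_ : ∀ {V W} → Graph V → Graph W → Set
_⊑_ {V} {W} H G =
  ∃[ f ] (Injective {A = V} {B = W} _≡_ _≡_ f × (∀ {u v} → Adj H u v → Adj G (f u) (f v)))

infix 4 _⊑_

P : (n : ℕ) → Graph (Fin n)
P n .Adj i j = toℕ j ≡ suc (toℕ i) ⊎ toℕ i ≡ suc (toℕ j)
P n .adj? i j = (toℕ j ℕ.≟ suc (toℕ i)) ⊎-dec (toℕ i ℕ.≟ suc (toℕ j))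
P n .symm = swap
P n .irrefl refl (inj₁ e) = 1+n≢n (sym e)
P n .irrefl refl (inj₂ e) = 1+n≢n (sym e)

-- C[3+ k ] is the cycle on 3 + k vertices, so that only lengths ≥ 3 occur:
-- the path on these vertices together with an edge joining its two ends.
C[3+_] : (k : ℕ) → Graph (Fin (3 + k))
C[3+ k ] = record
  { Adj    = λ i j → Adj path i j ⊎ (Closing i j ⊎ Closing j i)
  ; adj?   = λ i j → adj? path i j ⊎-dec (closing? i j ⊎-dec closing? j i)
  ; symm   = λ { (inj₁ a) → inj₁ (symm path a) ; (inj₂ c) → inj₂ (swap c) }
  ; irrefl = λ { refl (inj₁ a)        → irrefl path refl a
               ; refl (inj₂ (inj₁ c)) → not-loop c
               ; refl (inj₂ (inj₂ c)) → not-loop c }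
  }
  where
  path = P (3 + k)

  Closing : Rel (Fin (3 + k)) 0ℓ
  Closing i j = toℕ i ≡ 0 × toℕ j ≡ 2 + k

  closing? : Decidable Closing
  closing? i j = (toℕ i ℕ.≟ 0) ×-dec (toℕ j ℕ.≟ 2 + k)

  not-loop : ∀ {i} → ¬ Closing i i
  not-loop (e₀ , e₁) with trans (sym e₀) e₁
  ... | ()

_∪ᴳ_ : ∀ {V W} → Graph V → Graph W → Graph (V ⊎ W)
(G ∪ᴳ H) .Adj (inj₁ u) (inj₁ v) = Adj G u v
(G ∪ᴳ H) .Adj (inj₂ u) (inj₂ v) = Adj H u v
(G ∪ᴳ H) .Adj (inj₁ _) (inj₂ _) = ⊥
(G ∪ᴳ H) .Adj (inj₂ _) (inj₁ _) = ⊥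
(G ∪ᴳ H) .adj? (inj₁ u) (inj₁ v) = adj? G u v
(G ∪ᴳ H) .adj? (inj₂ u) (inj₂ v) = adj? H u v
(G ∪ᴳ H) .adj? (inj₁ _) (inj₂ _) = no λ ()
(G ∪ᴳ H) .adj? (inj₂ _) (inj₁ _) = no λ ()
(G ∪ᴳ H) .symm {inj₁ _} {inj₁ _} a = symm G a
(G ∪ᴳ H) .symm {inj₂ _} {inj₂ _} a = symm H a
(G ∪ᴳ H) .irrefl {inj₁ _} refl a = irrefl G refl a
(G ∪ᴳ H) .irrefl {inj₂ _} refl a = irrefl H refl a

-- withPendants G attaches to each vertex inj₁ v of G one new vertex inj₂ v.
withPendants : ∀ {n} → Graph (Fin n) → Graph (Fin n ⊎ Fin n)
withPendants G .Adj (inj₁ u) (inj₁ v) = Adj G u v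
withPendants G .Adj (inj₁ u) (inj₂ v) = u ≡ v
withPendants G .Adj (inj₂ u) (inj₁ v) = u ≡ v
withPendants G .Adj (inj₂ _) (inj₂ _) = ⊥
withPendants G .adj? (inj₁ u) (inj₁ v) = adj? G u v
withPendants G .adj? (inj₁ u) (inj₂ v) = u Fin.≟ v
withPendants G .adj? (inj₂ u) (inj₁ v) = u Fin.≟ v
withPendants G .adj? (inj₂ _) (inj₂ _) = no λ ()
withPendants G .symm {inj₁ _} {inj₁ _} a = symm G a
withPendants G .symm {inj₁ _} {inj₂ _} e = sym e
withPendants G .symm {inj₂ _} {inj₁ _} e = sym e
withPendants G .irrefl {inj₁ _} refl a = irrefl G refl a
withPendants G .irrefl {inj₂ _} refl ()

P₃ : Graph (Fin 3)
P₃ = P 3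

2P₃ : Graph (Fin 3 ⊎ Fin 3)
2P₃ = P₃ ∪ᴳ P₃

C₄ : Graph (Fin 4)
C₄ = C[3+ 1 ]

3-sunlet : Graph (Fin 3 ⊎ Fin 3)
3-sunlet = withPendants C[3+ 0 ]

data Player : Set where
  avoider enforcer : Player

opponent : Player → Player
opponent avoider  = enforcer
opponent enforcer = avoider

-- Records, for each vertex, who has picked it (if anyone).
Position : ℕ → Set
Position n = Vec (Maybe Player) n

initial : ∀ n → Position n
initial n = replicate n nothing

Free : ∀ {n} → Position n → Fin n → Set
Free pos v = lookup pos v ≡ nothing

pick : ∀ {n} → Position n → Fin n → Player → Position n
pick pos v X = pos [ v ]≔ just X

Full : ∀ {n} → Position n → Set
Full pos = ∀ v → ¬ Free pos v

module _ {n} (G : Graph (Fin n)) where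

  AvoiderTookEdge : Position n → Set
  AvoiderTookEdge pos = ∃[ u ] ∃[ v ]
    (Adj G u v × lookup pos u ≡ just avoider × lookup pos v ≡ just avoider)

  -- Evaluated at full positions only.
  WonBy : Player → Position n → Set
  WonBy enforcer pos = AvoiderTookEdge pos
  WonBy avoider  pos = ¬ AvoiderTookEdge pos

  -- Winning strategies of X, as trees: one move of X whenever X is to play, and
  -- one continuation for every legal move of the opponent.  In `reply`, the
  -- position must not be full, as otherwise a lost final position would be
  -- winning vacuously.
  data WinningStrategy (X : Player) (turn : Player) (pos : Position n) : Set where
    finish : Full pos → WonBy X pos → WinningStrategy X turn pos
    play   : turn ≡ X → (v : Fin n) → Free pos v →
             WinningStrategy X (opponent turn) (pick pos v turn) →
             WinningStrategy X turn pos
    reply  : turn ≢ X → ∃ (Free pos) →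
             (∀ v → Free pos v →
                WinningStrategy X (opponent turn) (pick pos v turn)) →
             WinningStrategy X turn pos

-- The player making the last move when `first` makes the first of n moves.
lastPlayer : ℕ → Player → Player
lastPlayer n first = if (n % 2 ≡ᵇ 1) then first else opponent first

secondToLastPlayer : ℕ → Player → Player
secondToLastPlayer n first = opponent (lastPlayer n first)

WinsAsLast : ∀ {n} → Player → Graph (Fin n) → Set
WinsAsLast {n} X G =
  ∀ first → lastPlayer n first ≡ X → WinningStrategy G X first (initial n)

WinsAsSecondToLast : ∀ {n} → Player → Graph (Fin n) → Set
WinsAsSecondToLast {n} X G =
  ∀ first → secondToLastPlayer n first ≡ X → WinningStrategy G X first (initial n)

data Outcome : Set where
  𝒜 ℰ 𝒮ℒ : Outcome

-- o[ G ]= ω : the outcome of G is ω.  See o-unique below for single-valuedness.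
o[_]=_ : ∀ {n} → Graph (Fin n) → Outcome → Set
o[ G ]= 𝒜  = WinsAsLast avoider G × WinsAsSecondToLast avoider G
o[ G ]= ℰ  = WinsAsLast enforcer G × WinsAsSecondToLast enforcer G
o[ G ]= 𝒮ℒ = ∀ X → WinsAsSecondToLast X G

infix 4 o[_]=_

not-both : ∀ {n} {G : Graph (Fin n)} {turn pos} →
           WinningStrategy G avoider turn pos → WinningStrategy G enforcer turn pos → ⊥
not-both (finish _ a)       (finish _ e)       = a e
not-both (finish full _)    (play _ v f _)     = full v f
not-both (finish full _)    (reply _ (v , f) _) = full v f
not-both (play _ v f _)     (finish full _)    = full v f
not-both (play refl _ _ _)  (play () _ _ _)
not-both (play _ v f s)     (reply _ _ r)      = not-both s (r v f)
not-both (reply _ (v , f) _) (finish full _)   = full v f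
not-both (reply _ _ r)      (play _ v f s)     = not-both (r v f) s
not-both {turn = avoider}  (reply a≢a _ _) (reply _ _ _)   = a≢a refl
not-both {turn = enforcer} (reply _ _ _)   (reply e≢e _ _) = e≢e refl

private
  opponent² : ∀ X → opponent (opponent X) ≡ X
  opponent² avoider  = refl
  opponent² enforcer = refl

  -- The starting player for which X is last.
  starter : ∀ n X → ∃[ first ] lastPlayer n first ≡ X
  starter n X with n % 2 ≡ᵇ 1
  ... | true  = X , refl
  ... | false = opponent X , opponent² X

  clash-last : ∀ {n} {G : Graph (Fin n)} →
               WinsAsLast avoider G → WinsAsSecondToLast enforcer G → ⊥
  clash-last {n} a e with starter n avoider
  ... | first , p = not-both (a first p) (e first (cong opponent p))

  clash-stl : ∀ {n} {G : Graph (Fin n)} →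
              WinsAsSecondToLast avoider G → WinsAsLast enforcer G → ⊥
  clash-stl {n} a e with starter n enforcer
  ... | first , p = not-both (a first (cong opponent p)) (e first p)

o-unique : ∀ {n} (G : Graph (Fin n)) {ω ω′} → o[ G ]= ω → o[ G ]= ω′ → ω ≡ ω′
o-unique G {𝒜}  {𝒜}  _ _ = refl
o-unique G {ℰ}  {ℰ}  _ _ = refl
o-unique G {𝒮ℒ} {𝒮ℒ} _ _ = refl
o-unique G {𝒜}  {ℰ}  (a , _) (_ , e) with () ← clash-last a e
o-unique G {ℰ}  {𝒜}  (_ , e) (a , _) with () ← clash-last a e
o-unique G {𝒜}  {𝒮ℒ} (a , _) s with () ← clash-last a (s enforcer)
o-unique G {𝒮ℒ} {𝒜}  s (a , _) with () ← clash-last a (s enforcer)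
o-unique G {ℰ}  {𝒮ℒ} (e , _) s with () ← clash-stl (s avoider) e
o-unique G {𝒮ℒ} {ℰ}  s (e , _) with () ← clash-stl (s avoider) e

{-# OPTIONS --safe #-}
module Submission where

open import Defs
open import Data.Bool using (true; false)
open import Data.Fin using (Fin; zero; suc; toℕ; inject₁; join; splitAt; #_)
open import Data.Fin.Properties using (_≟_; any?; all?; inject₁-injective; +↔⊎)
open import Data.Maybe using (just; nothing)
open import Data.Maybe.Properties using (≡-dec)
open import Data.Nat using (ℕ; zero; suc; _+_; _*_; _%_; _≡ᵇ_)
open import Data.Nat.Properties using (suc-injective; +-comm; +-suc; +-cancelˡ-≡)
open import Data.Product using (Σ; ∃; ∃-syntax; _×_; _,_; proj₁; proj₂)
open import Data.Sum using (_⊎_; inj₁; inj₂)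
open import Data.Sum.Properties using (inj₁-injective)
open import Data.Vec using (Vec; []; _∷_; lookup; tabulate)
import Data.Vec.Membership.DecPropositional as DecMembership
open import Data.Vec.Membership.Propositional using (_∈_; _∉_)
open import Data.Vec.Membership.Propositional.Properties using (∈-tabulate⁺)
open import Data.Vec.Properties using (lookup∘update; lookup∘update′; lookup-replicate; []≔-commutes)
open import Data.Vec.Relation.Unary.All as All using (All; []; _∷_)
open import Data.Vec.Relation.Unary.AllPairs using (allPairs?)
open import Data.Vec.Relation.Unary.Any using (here; there)
open import Data.Vec.Relation.Unary.Unique.Propositional using (Unique; []; _∷_)
open import Data.Vec.Relation.Unary.Unique.Propositional.Properties using (lookup-injective; tabulate⁺)
open import Function using (_∘_; id; Injective; Injection)
open import Function.Properties.Inverse using (↔-sym; Inverse⇒Injection)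
open import Relation.Binary.Definitions using (DecidableEquality)
open import Relation.Binary.PropositionalEquality using (_≡_; _≢_; refl; sym; trans; cong; subst; ≢-sym)
open import Relation.Nullary using (¬_; Dec; yes; no; contradiction)
open import Relation.Nullary.Decidable using (True; toWitness; from-yes; ¬?; _×-dec_; decidable-stable; map′)

-- Avoider, as last player on a matching, can always take a vertex without free neighbours:
-- an odd number of free vertices cannot be perfectly matched.  The same works for the
-- second-to-last player if some free vertex c meets every free P₃: ignore c until Enforcer
-- takes it.  In a graph without 2P₃, C₄ and 3-sunlet, if no vertex meets every P₃ then there
-- is a component C₅ or a bull (a triangle with two pendent edges at different vertices) and
-- the rest is a matching; as 5 is odd, an even order yields an isolated vertex to take.
--
-- Enforcer wins moving second on P₃, 2P₃, C₄ and the 3-sunlet, by exhaustive search.  On a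
-- larger graph the other vertices are paired off, Enforcer starting with one of them if
-- their number is odd.

pattern #0 = zero
pattern #1 = suc zero
pattern #2 = suc (suc zero)
pattern #3 = suc (suc (suc zero))

-- Homomorphisms from small paths and cycles.

⊑-trans : ∀ {U V W} (F : Graph U) (G : Graph V) (H : Graph W) → F ⊑ G → G ⊑ H → F ⊑ H
⊑-trans F G H (f , f-inj , f-adj) (g , g-inj , g-adj) = g ∘ f , f-inj ∘ g-inj , g-adj ∘ f-adj

module _ {V : Set} (G : Graph V) where

  path-hom : ∀ {k} (f : Fin k → V) →
             (∀ i j → toℕ j ≡ suc (toℕ i) → Adj G (f i) (f j)) →
             ∀ {i j} → Adj (P k) i j → Adj G (f i) (f j)
  path-hom f step (inj₁ e) = step _ _ e
  path-hom f step (inj₂ e) = symm G (step _ _ e)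

  cycle-hom : ∀ {k} (f : Fin (3 + k) → V) →
              (∀ i j → toℕ j ≡ suc (toℕ i) → Adj G (f i) (f j)) →
              (∀ i j → toℕ i ≡ 0 → toℕ j ≡ 2 + k → Adj G (f i) (f j)) →
              ∀ {i j} → Adj C[3+ k ] i j → Adj G (f i) (f j)
  cycle-hom f step close (inj₁ a)                = path-hom f step a
  cycle-hom f step close (inj₂ (inj₁ (e , e′))) = close _ _ e e′
  cycle-hom f step close (inj₂ (inj₂ (e , e′))) = symm G (close _ _ e e′)

  P₃-hom : (f : Fin 3 → V) → Adj G (f #0) (f #1) → Adj G (f #1) (f #2) →
           ∀ {i j} → Adj P₃ i j → Adj G (f i) (f j)
  P₃-hom f e₀ e₁ = path-hom f step
    where
    step : ∀ i j → toℕ j ≡ suc (toℕ i) → Adj G (f i) (f j)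
    step #0 #1 _ = e₀
    step #1 #2 _ = e₁

  C₃-hom : (f : Fin 3 → V) → Adj G (f #0) (f #1) → Adj G (f #1) (f #2) → Adj G (f #2) (f #0) →
           ∀ {i j} → Adj C[3+ 0 ] i j → Adj G (f i) (f j)
  C₃-hom f e₀ e₁ e₂ = cycle-hom f step close
    where
    step : ∀ i j → toℕ j ≡ suc (toℕ i) → Adj G (f i) (f j)
    step #0 #1 _ = e₀
    step #1 #2 _ = e₁

    close : ∀ i j → toℕ i ≡ 0 → toℕ j ≡ 2 → Adj G (f i) (f j)
    close #0 #2 _ _ = symm G e₂

  C₄-hom : (f : Fin 4 → V) →
           Adj G (f #0) (f #1) → Adj G (f #1) (f #2) → Adj G (f #2) (f #3) → Adj G (f #3) (f #0) →
           ∀ {i j} → Adj C₄ i j → Adj G (f i) (f j)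
  C₄-hom f e₀ e₁ e₂ e₃ = cycle-hom f step close
    where
    step : ∀ i j → toℕ j ≡ suc (toℕ i) → Adj G (f i) (f j)
    step #0 #1 _ = e₀
    step #1 #2 _ = e₁
    step #2 #3 _ = e₂

    close : ∀ i j → toℕ i ≡ 0 → toℕ j ≡ 3 → Adj G (f i) (f j)
    close #0 #3 _ _ = symm G e₃

distinct? : ∀ {m k} (vs : Vec (Fin m) k) → Dec (Unique vs)
distinct? = allPairs? λ i j → ¬? (i ≟ j)

_∈?_ : ∀ {m k} (i : Fin m) (vs : Vec (Fin m) k) → Dec (i ∈ vs)
i ∈? vs = DecMembership._∈?_ _≟_ i vs

infix 4 _∈?_

∉⇒All≢ : ∀ {m k} {i : Fin m} {vs : Vec (Fin m) k} → i ∉ vs → All (i ≢_) vs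
∉⇒All≢ {vs = []}    i∉ = []
∉⇒All≢ {vs = _ ∷ _} i∉ = (i∉ ∘ here) ∷ ∉⇒All≢ (i∉ ∘ there)

PatternFree : ∀ {V} → Graph V → Set
PatternFree G = ¬ ((2P₃ ⊑ G) ⊎ (C₄ ⊑ G) ⊎ (3-sunlet ⊑ G))

-- Structure of graphs without `2P₃`, `C₄` and `3-sunlet`.

module _ {n : ℕ} (G : Graph (Fin n)) where

  private
    infix 4 _~_
    _~_ : Fin n → Fin n → Set
    _~_ = Adj G

    -- Patterns are located by indices into a vector of distinct vertices, so that
    -- the distinctness of the indices is decided by computation.
    location-injective : ∀ {m} {vs : Vec (Fin n) m} → Unique vs → (is : Vec (Fin m) 6) → Unique is →
                         Injective {A = Fin 3 ⊎ Fin 3} _≡_ _≡_ (λ i → lookup vs (lookup is (join 3 3 i)))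
    location-injective vs! is is! =
      Injection.injective (Inverse⇒Injection (↔-sym (+↔⊎ {3} {3})))
      ∘ lookup-injective is! _ _ ∘ lookup-injective vs! _ _

  2P₃-at : ∀ {m} {vs : Vec (Fin n) m} → Unique vs →
           ∀ a b c d e f → {_ : True (distinct? (a ∷ b ∷ c ∷ d ∷ e ∷ f ∷ []))} →
           lookup vs a ~ lookup vs b → lookup vs b ~ lookup vs c →
           lookup vs d ~ lookup vs e → lookup vs e ~ lookup vs f → 2P₃ ⊑ G
  2P₃-at {m} {vs} vs! a b c d e f {is!} ab bc de ef =
    _ , location-injective vs! is (toWitness is!) , λ {i} {j} → hom i j
    where
    is = a ∷ b ∷ c ∷ d ∷ e ∷ f ∷ []

    at : Fin 3 ⊎ Fin 3 → Fin n
    at i = lookup vs (lookup is (join 3 3 i))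

    hom : ∀ i j → Adj 2P₃ i j → at i ~ at j
    hom (inj₁ i) (inj₁ j) = P₃-hom G (at ∘ inj₁) ab bc
    hom (inj₂ i) (inj₂ j) = P₃-hom G (at ∘ inj₂) de ef

  sunlet-at : ∀ {m} {vs : Vec (Fin n) m} → Unique vs →
              ∀ a b c x y z → {_ : True (distinct? (a ∷ b ∷ c ∷ x ∷ y ∷ z ∷ []))} →
              lookup vs a ~ lookup vs b → lookup vs b ~ lookup vs c → lookup vs c ~ lookup vs a →
              lookup vs a ~ lookup vs x → lookup vs b ~ lookup vs y → lookup vs c ~ lookup vs z →
              3-sunlet ⊑ G
  sunlet-at {m} {vs} vs! a b c x y z {is!} ab bc ca ax by cz =
    _ , location-injective vs! is (toWitness is!) , λ {i} {j} → hom i j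
    where
    is = a ∷ b ∷ c ∷ x ∷ y ∷ z ∷ []

    at : Fin 3 ⊎ Fin 3 → Fin n
    at i = lookup vs (lookup is (join 3 3 i))

    pendant : ∀ i → at (inj₁ i) ~ at (inj₂ i)
    pendant #0 = ax
    pendant #1 = by
    pendant #2 = cz

    hom : ∀ i j → Adj 3-sunlet i j → at i ~ at j
    hom (inj₁ i) (inj₁ j) a    = C₃-hom G (at ∘ inj₁) ab bc ca a
    hom (inj₁ i) (inj₂ j) refl = pendant i
    hom (inj₂ i) (inj₁ j) refl = symm G (pendant i)

  adj⇒≢ : ∀ {u v} → u ~ v → u ≢ v
  adj⇒≢ uv u≡v = irrefl G u≡v uv

  4-cycle : ∀ {a b c d} → a ~ b → b ~ c → c ~ d → d ~ a → a ≢ c → b ≢ d → C₄ ⊑ G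
  4-cycle {a} {b} {c} {d} ab bc cd da a≢c b≢d =
    lookup vs , lookup-injective vs! _ _ , C₄-hom G (lookup vs) ab bc cd da
    where
    vs = a ∷ b ∷ c ∷ d ∷ []

    vs! : Unique vs
    vs! = (adj⇒≢ ab ∷ a≢c ∷ ≢-sym (adj⇒≢ da) ∷ []) ∷ (adj⇒≢ bc ∷ b≢d ∷ []) ∷ (adj⇒≢ cd ∷ []) ∷ [] ∷ []

  record Path₃ : Set where
    constructor path₃
    field
      {p q r} : Fin n
      pq      : p ~ q
      qr      : q ~ r
      p≢r     : p ≢ r

    vertices : Vec (Fin n) 3
    vertices = p ∷ q ∷ r ∷ []

  open Path₃ public using (vertices)

  Avoids : Path₃ → Fin n → Set
  Avoids π v = v ∉ vertices π


  -- Typically `x` and `y` are joined through a vertex off `π`. Then `between` closes a 4-cycle,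
  -- while the hanging cases give a triangle with one further edge at `x` or `y`.
  data Span (π : Path₃) (x y : Fin n) : Set where
    hangingˡ : ∀ {w} → w ∈ vertices π → x ~ y → x ~ w → w ≢ y → Span π x y
    hangingʳ : ∀ {w} → w ∈ vertices π → x ~ y → y ~ w → w ≢ x → Span π x y
    between  : ∀ {w} → w ∈ vertices π → x ~ w → w ~ y → Span π x y

  span : ∀ π {x y} → x ∈ vertices π → y ∈ vertices π → x ≢ y → Span π x y
  span (path₃ pq qr p≢r) (here refl) (here refl) x≢y = contradiction refl x≢y
  span (path₃ pq qr p≢r) (here refl) (there (here refl)) _ =
    hangingʳ (there (there (here refl))) pq qr (≢-sym p≢r)
  span (path₃ pq qr p≢r) (here refl) (there (there (here refl))) _ =
    between (there (here refl)) pq qr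
  span (path₃ pq qr p≢r) (there (here refl)) (here refl) _ =
    hangingˡ (there (there (here refl))) (symm G pq) qr (≢-sym p≢r)
  span (path₃ pq qr p≢r) (there (here refl)) (there (here refl)) x≢y = contradiction refl x≢y
  span (path₃ pq qr p≢r) (there (here refl)) (there (there (here refl))) _ =
    hangingˡ (here refl) qr (symm G pq) p≢r
  span (path₃ pq qr p≢r) (there (there (here refl))) (here refl) _ =
    between (there (here refl)) (symm G qr) (symm G pq)
  span (path₃ pq qr p≢r) (there (there (here refl))) (there (here refl)) _ =
    hangingʳ (here refl) (symm G qr) (symm G pq) p≢r
  span (path₃ pq qr p≢r) (there (there (here refl))) (there (there (here refl))) x≢y =
    contradiction refl x≢y

  -- The instances are the components C₅ and the bull.
  record Island : Set where
    field
      shore  : Vec (Fin n) 5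
      shore! : Unique shore
      closed : ∀ {v w} → v ∈ shore → v ~ w → w ∈ shore
      inner  : ∀ {v} → v ∈ shore → ∃ (v ~_)
      meets  : ∀ π → ∃[ v ] (v ∈ shore × v ∈ vertices π)

  module _ (free : PatternFree G) where

    no-2P₃ : ¬ (2P₃ ⊑ G)
    no-2P₃ = free ∘ inj₁

    no-C₄ : ¬ (C₄ ⊑ G)
    no-C₄ = free ∘ inj₂ ∘ inj₁

    no-sunlet : ¬ (3-sunlet ⊑ G)
    no-sunlet = free ∘ inj₂ ∘ inj₂

    -- Otherwise the six vertices are distinct and the two paths form a `2P₃`.
    paths-meet : ∀ π ρ → ∃[ v ] (v ∈ vertices π × v ∈ vertices ρ)
    paths-meet π@(path₃ {p} {q} {r} pq qr p≢r) ρ@(path₃ {s} {t} {u} st tu s≢u)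
      with p ∈? vertices ρ | q ∈? vertices ρ | r ∈? vertices ρ
    ... | yes p∈ | _      | _      = _ , here refl , p∈
    ... | _      | yes q∈ | _      = _ , there (here refl) , q∈
    ... | _      | _      | yes r∈ = _ , there (there (here refl)) , r∈
    ... | no p∉  | no q∉  | no r∉  =
      contradiction (2P₃-at vs! (# 0) (# 1) (# 2) (# 3) (# 4) (# 5) pq qr st tu) no-2P₃
      where
      vs! : Unique (p ∷ q ∷ r ∷ vertices ρ)
      vs! = (adj⇒≢ pq ∷ p≢r ∷ ∉⇒All≢ p∉)
          ∷ (adj⇒≢ qr ∷ ∉⇒All≢ q∉)
          ∷ ∉⇒All≢ r∉
          ∷ (adj⇒≢ st ∷ s≢u ∷ []) ∷ (adj⇒≢ tu ∷ []) ∷ [] ∷ []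

    -- An edge leaving the shore at `a`, `b`, `x` or `y` completes a `2P₃`; one leaving at `c`
    -- completes a 3-sunlet. Every path on three vertices meets the path `a`, `b`, `c`, hence the
    -- shore.
    bull : ∀ {a b c x y} → a ~ b → b ~ c → c ~ a → a ~ x → b ~ y →
           x ≢ y → x ≢ b → x ≢ c → y ≢ a → y ≢ c → Island
    bull {a} {b} {c} {x} {y} ab bc ca ax by x≢y x≢b x≢c y≢a y≢c = record
      { shore  = K
      ; shore! = K!
      ; closed = λ {_} {w} v∈K vw → decidable-stable (w ∈? K) λ w∉K → outside w∉K v∈K vw
      ; inner  = λ { (here refl)                         → _ , ab
                   ; (there (here refl))                 → _ , bc
                   ; (there (there (here refl)))         → _ , ca
                   ; (there (there (there (here refl)))) → _ , symm G ax
                   ; (there (there (there (there (here refl))))) → _ , symm G by }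
      ; meets  = λ π → let v , v∈ , v∈π = paths-meet (path₃ ab bc (≢-sym (adj⇒≢ ca))) π in
                       v , first-three v∈ , v∈π
      }
      where
      K = a ∷ b ∷ c ∷ x ∷ y ∷ []

      K! : Unique K
      K! = (adj⇒≢ ab ∷ ≢-sym (adj⇒≢ ca) ∷ adj⇒≢ ax ∷ ≢-sym y≢a ∷ [])
         ∷ (adj⇒≢ bc ∷ ≢-sym x≢b ∷ adj⇒≢ by ∷ [])
         ∷ (≢-sym x≢c ∷ ≢-sym y≢c ∷ []) ∷ (x≢y ∷ []) ∷ [] ∷ []

      first-three : ∀ {v} → v ∈ a ∷ b ∷ c ∷ [] → v ∈ K
      first-three (here e)                 = here e
      first-three (there (here e))         = there (here e)
      first-three (there (there (here e))) = there (there (here e))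

      outside : ∀ {v w} → w ∉ K → v ∈ K → ¬ (v ~ w)
      outside w∉ (here refl) aw =
        no-2P₃ (2P₃-at (∉⇒All≢ w∉ ∷ K!) (# 0) (# 1) (# 4) (# 3) (# 2) (# 5)
                       (symm G aw) ax (symm G bc) by)
      outside w∉ (there (here refl)) bw =
        no-2P₃ (2P₃-at (∉⇒All≢ w∉ ∷ K!) (# 0) (# 2) (# 5) (# 3) (# 1) (# 4)
                       (symm G bw) by ca ax)
      outside w∉ (there (there (here refl))) cw =
        no-sunlet (sunlet-at (∉⇒All≢ w∉ ∷ K!) (# 1) (# 2) (# 3) (# 4) (# 5) (# 0)
                             ab bc ca ax by cw)
      outside w∉ (there (there (there (here refl)))) xw =
        no-2P₃ (2P₃-at (∉⇒All≢ w∉ ∷ K!) (# 0) (# 4) (# 1) (# 3) (# 2) (# 5)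
                       (symm G xw) (symm G ax) (symm G bc) by)
      outside w∉ (there (there (there (there (here refl))))) yw =
        no-2P₃ (2P₃-at (∉⇒All≢ w∉ ∷ K!) (# 0) (# 5) (# 2) (# 3) (# 1) (# 4)
                       (symm G yw) (symm G by) ca ax)

    -- An edge leaving the cycle at some vertex forms, with the next cycle edge, a path that is
    -- disjoint from the path on the three other cycle vertices.
    5-cycle : ∀ {a b c d e} → a ~ b → b ~ c → c ~ d → d ~ e → e ~ a →
              Unique (a ∷ b ∷ c ∷ d ∷ e ∷ []) → Island
    5-cycle {a} {b} {c} {d} {e} ab bc cd de ea K! = record
      { shore  = K
      ; shore! = K!
      ; closed = λ {_} {w} v∈K vw → decidable-stable (w ∈? K) λ w∉K → outside w∉K v∈K vw
      ; inner  = λ { (here refl)                         → _ , ab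
                   ; (there (here refl))                 → _ , bc
                   ; (there (there (here refl)))         → _ , cd
                   ; (there (there (there (here refl)))) → _ , de
                   ; (there (there (there (there (here refl))))) → _ , ea }
      ; meets  = λ π → let v , v∈ , v∈π = paths-meet (path₃ ab bc a≢c) π in
                       v , first-three v∈ , v∈π
      }
      where
      K = a ∷ b ∷ c ∷ d ∷ e ∷ []

      a≢c : a ≢ c
      a≢c a≡c with () ← lookup-injective K! (# 0) (# 2) a≡c

      first-three : ∀ {v} → v ∈ a ∷ b ∷ c ∷ [] → v ∈ K
      first-three (here e)                 = here e
      first-three (there (here e))         = there (here e)
      first-three (there (there (here e))) = there (there (here e))

      outside : ∀ {v w} → w ∉ K → v ∈ K → ¬ (v ~ w)
      outside w∉ (here refl) aw =
        no-2P₃ (2P₃-at (∉⇒All≢ w∉ ∷ K!) (# 0) (# 1) (# 2) (# 3) (# 4) (# 5)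
                       (symm G aw) ab cd de)
      outside w∉ (there (here refl)) bw =
        no-2P₃ (2P₃-at (∉⇒All≢ w∉ ∷ K!) (# 0) (# 2) (# 3) (# 4) (# 5) (# 1)
                       (symm G bw) bc de ea)
      outside w∉ (there (there (here refl))) cw =
        no-2P₃ (2P₃-at (∉⇒All≢ w∉ ∷ K!) (# 0) (# 3) (# 4) (# 5) (# 1) (# 2)
                       (symm G cw) cd ea ab)
      outside w∉ (there (there (there (here refl)))) dw =
        no-2P₃ (2P₃-at (∉⇒All≢ w∉ ∷ K!) (# 0) (# 4) (# 5) (# 1) (# 2) (# 3)
                       (symm G dw) de ab bc)
      outside w∉ (there (there (there (there (here refl))))) ew =
        no-2P₃ (2P₃-at (∉⇒All≢ w∉ ∷ K!) (# 0) (# 5) (# 1) (# 2) (# 3) (# 4)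
                       (symm G ew) ea bc cd)

    off-path : ∀ {π v w} → v ∉ vertices π → w ∈ vertices π → w ≢ v
    off-path {π} v∉ w∈ w≡v = v∉ (subst (_∈ vertices π) w≡v w∈)

    -- On the triangle `b`, `x`, `y` sit the further edges `b z` and `x w`. If `z` and `w` coincide,
    -- `b`, `y`, `x`, `z` is a 4-cycle; otherwise this is a bull.
    claw-triangle : ∀ {b x y z w} → b ~ x → b ~ y → b ~ z → x ≢ z → y ≢ z →
                    x ~ y → x ~ w → w ≢ b → w ≢ y → Island
    claw-triangle {z = z} {w} bx by bz x≢z y≢z xy xw w≢b w≢y with z ≟ w
    ... | yes refl = contradiction (4-cycle by (symm G xy) xw (symm G bz) (adj⇒≢ bx) y≢z) no-C₄
    ... | no z≢w   = bull bx xy (symm G by) bz xw z≢w (≢-sym x≢z) (≢-sym y≢z) w≢b w≢y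

    claw-through : ∀ {b x y z} → b ~ x → b ~ y → b ~ z → x ≢ y → x ≢ z → y ≢ z →
                   ∀ π → Avoids π b → x ∈ vertices π → y ∈ vertices π → Island
    claw-through bx by bz x≢y x≢z y≢z π b∉ x∈ y∈ with span π x∈ y∈ x≢y
    ... | hangingˡ w∈ xy xw w≢y = claw-triangle bx by bz x≢z y≢z xy xw (off-path {π} b∉ w∈) w≢y
    ... | hangingʳ w∈ xy yw w≢x =
      claw-triangle by bx bz y≢z x≢z (symm G xy) yw (off-path {π} b∉ w∈) w≢x
    ... | between w∈ xw wy =
      contradiction (4-cycle bx xw wy (symm G by) (≢-sym (off-path {π} b∉ w∈)) x≢y) no-C₄

    -- The path `x`, `b`, `y` has to meet `π`. Applied to each pair among three neighbours of `b`,
    -- this puts at least two of them on `π`.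
    two-neighbours-meet : ∀ {b x y} → b ~ x → b ~ y → x ≢ y →
                          ∀ π → Avoids π b → Avoids π x → ¬ Avoids π y
    two-neighbours-meet bx by x≢y π b∉ x∉ y∉ with paths-meet (path₃ (symm G bx) by x≢y) π
    ... | _ , here refl , x∈                 = x∉ x∈
    ... | _ , there (here refl) , b∈         = b∉ b∈
    ... | _ , there (there (here refl)) , y∈ = y∉ y∈

    claw : ∀ {b x y z} → b ~ x → b ~ y → b ~ z → x ≢ y → x ≢ z → y ≢ z →
           ∀ π → Avoids π b → Island
    claw {b} {x} {y} {z} bx by bz x≢y x≢z y≢z π b∉
      with x ∈? vertices π | y ∈? vertices π | z ∈? vertices π
    ... | yes x∈ | yes y∈ | _      = claw-through bx by bz x≢y x≢z y≢z π b∉ x∈ y∈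
    ... | yes x∈ | no _   | yes z∈ = claw-through bx bz by x≢z x≢y (≢-sym y≢z) π b∉ x∈ z∈
    ... | no _   | yes y∈ | yes z∈ = claw-through by bz bx y≢z (≢-sym x≢y) (≢-sym x≢z) π b∉ y∈ z∈
    ... | no x∉  | no y∉  | _      = contradiction y∉ (two-neighbours-meet bx by x≢y π b∉ x∉)
    ... | no x∉  | yes _  | no z∉  = contradiction z∉ (two-neighbours-meet bx bz x≢z π b∉ x∉)
    ... | yes _  | no y∉  | no z∉  = contradiction z∉ (two-neighbours-meet by bz y≢z π b∉ y∉)

    -- Islands in graphs where no vertex meets every path on three vertices.

    module _ (avoiding : ∀ {c d} → c ~ d → ∃[ π ] Avoids π c) where

      claw-island : ∀ {b x y z} → b ~ x → b ~ y → b ~ z → x ≢ y → x ≢ z → y ≢ z → Island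
      claw-island bx by bz x≢y x≢z y≢z =
        let π , b∉ = avoiding bx in claw bx by bz x≢y x≢z y≢z π b∉

      -- The path `π` meets `a`, `b`, `c` at `b` or `c`, so `span` relates `x` to that vertex. An
      -- edge `x b` gives `x` a third neighbour, and an edge `x c` closes a 4-cycle. A common
      -- neighbour of `x` and `b` on `π` closes a 4-cycle. A common neighbour of `x` and `c` closes
      -- a 5-cycle if it is `y`, and otherwise is a third neighbour of `x`.
      P₅-through : ∀ {y x a b c} → y ~ x → x ~ a → a ~ b → b ~ c →
                   y ≢ a → y ≢ b → y ≢ c → x ≢ b → x ≢ c → a ≢ c →
                   ∀ π → Avoids π a → x ∈ vertices π → Island
      P₅-through {y} {x} {a} {b} {c} yx xa ab bc y≢a y≢b y≢c x≢b x≢c a≢c π a∉ x∈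
        with paths-meet (path₃ ab bc a≢c) π
      ... | _ , here refl , a∈ = contradiction a∈ a∉
      ... | _ , there (here refl) , b∈ with span π x∈ b∈ x≢b
      ...   | hangingˡ _ xb _ _ = claw-island xa (symm G yx) xb (≢-sym y≢a) (adj⇒≢ ab) y≢b
      ...   | hangingʳ _ xb _ _ = claw-island xa (symm G yx) xb (≢-sym y≢a) (adj⇒≢ ab) y≢b
      ...   | between w∈ xw wb  =
        contradiction (4-cycle (symm G xa) xw wb (symm G ab) (≢-sym (off-path {π} a∉ w∈)) x≢b) no-C₄
      P₅-through {y} {x} {a} {b} {c} yx xa ab bc y≢a y≢b y≢c x≢b x≢c a≢c π a∉ x∈
          | _ , there (there (here refl)) , c∈ with span π x∈ c∈ x≢c
      ...   | hangingˡ _ xc _ _ = contradiction (4-cycle xa ab bc (symm G xc) x≢b a≢c) no-C₄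
      ...   | hangingʳ _ xc _ _ = contradiction (4-cycle xa ab bc (symm G xc) x≢b a≢c) no-C₄
      ...   | between {w} w∈ xw wc with y ≟ w
      ...     | no y≢w   =
        claw-island xa (symm G yx) xw (≢-sym y≢a) (≢-sym (off-path {π} a∉ w∈)) y≢w
      ...     | yes refl = 5-cycle yx xa ab bc (symm G wc)
        ( (adj⇒≢ yx ∷ y≢a ∷ y≢b ∷ y≢c ∷ []) ∷ (adj⇒≢ xa ∷ x≢b ∷ x≢c ∷ [])
        ∷ (adj⇒≢ ab ∷ a≢c ∷ []) ∷ (adj⇒≢ bc ∷ []) ∷ [] ∷ [])

      -- Some path avoids the middle vertex `a` but meets `x`, `a`, `b`, hence contains `x` or `b`.
      -- Reversing the five-vertex path exchanges the two cases.
      P₅-island : ∀ {y x a b c} → y ~ x → x ~ a → a ~ b → b ~ c →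
                  y ≢ a → y ≢ b → y ≢ c → x ≢ b → x ≢ c → a ≢ c → Island
      P₅-island yx xa ab bc y≢a y≢b y≢c x≢b x≢c a≢c
        with π , a∉ ← avoiding ab
        with paths-meet (path₃ xa ab x≢b) π
      ... | _ , here refl , x∈ = P₅-through yx xa ab bc y≢a y≢b y≢c x≢b x≢c a≢c π a∉ x∈
      ... | _ , there (here refl) , a∈ = contradiction a∈ a∉
      ... | _ , there (there (here refl)) , b∈ =
        P₅-through (symm G bc) (symm G ab) (symm G xa) (symm G yx)
                   (≢-sym a≢c) (≢-sym x≢c) (≢-sym y≢c) (≢-sym x≢b) (≢-sym y≢b) (≢-sym y≢a) π a∉ b∈

      -- If `π` also contains `c`, then `span` yields a 4-cycle or a vertex with three neighbours.
      -- Otherwise `π` shares only `a` with the path `a`, `b`, `c`, and the two are glued there.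
      P₃-through : ∀ {a b c} → a ~ b → b ~ c → a ≢ c →
                   ∀ π → Avoids π b → a ∈ vertices π → Island
      P₃-through {a} {b} {c} ab bc a≢c π b∉ a∈ with c ∈? vertices π
      ... | yes c∈ with span π a∈ c∈ a≢c
      ...   | hangingˡ w∈ ac aw w≢c =
        claw-island ab ac aw (adj⇒≢ bc) (≢-sym (off-path {π} b∉ w∈)) (≢-sym w≢c)
      ...   | hangingʳ w∈ ac cw w≢a =
        claw-island (symm G bc) (symm G ac) cw (≢-sym (adj⇒≢ ab)) (≢-sym (off-path {π} b∉ w∈)) (≢-sym w≢a)
      ...   | between w∈ aw wc =
        contradiction (4-cycle (symm G ab) aw wc (symm G bc) (≢-sym (off-path {π} b∉ w∈)) a≢c) no-C₄
      P₃-through {a} {b} {c} ab bc a≢c π b∉ a∈ | no c∉ = lone π b∉ c∉ a∈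
        where
        lone : ∀ π → Avoids π b → Avoids π c → a ∈ vertices π → Island
        -- If `a` is an end of `π`, then `π` followed by `b`, `c` is a path on five vertices; if `a`
        -- is its middle, then `a` has three neighbours.
        lone π@(path₃ ax xy a≢y) b∉ c∉ (here refl) =
          P₅-island (symm G xy) (symm G ax) ab bc (≢-sym a≢y)
            (b∉ ∘ there ∘ there ∘ here ∘ sym) (c∉ ∘ there ∘ there ∘ here ∘ sym)
            (b∉ ∘ there ∘ here ∘ sym) (c∉ ∘ there ∘ here ∘ sym) a≢c
        lone π@(path₃ xa ay x≢y) b∉ c∉ (there (here refl)) =
          claw-island ab (symm G xa) ay (b∉ ∘ here) (b∉ ∘ there ∘ there ∘ here) x≢y
        lone π@(path₃ yx xa y≢a) b∉ c∉ (there (there (here refl))) =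
          P₅-island yx xa ab bc y≢a
            (b∉ ∘ here ∘ sym) (c∉ ∘ here ∘ sym)
            (b∉ ∘ there ∘ here ∘ sym) (c∉ ∘ there ∘ here ∘ sym) a≢c

      -- A path avoiding the middle vertex `q` still meets `p`, `q`, `r`, so it passes through one
      -- of the ends.
      island : Path₃ → Island
      island π@(path₃ pq qr p≢r) with ρ , q∉ ← avoiding qr with paths-meet π ρ
      ... | _ , here refl , p∈                 = P₃-through pq qr p≢r ρ q∉ p∈
      ... | _ , there (here refl) , q∈         = contradiction q∈ q∉
      ... | _ , there (there (here refl)) , r∈ =
        P₃-through (symm G qr) (symm G pq) (≢-sym p≢r) ρ q∉ r∈

-- Positions and the number of free vertices.

_≟ᴾ_ : DecidableEquality Player
avoider  ≟ᴾ avoider  = yes refl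
avoider  ≟ᴾ enforcer = no λ ()
enforcer ≟ᴾ avoider  = no λ ()
enforcer ≟ᴾ enforcer = yes refl

free? : ∀ {n} (pos : Position n) v → Dec (Free pos v)
free? pos v = ≡-dec _≟ᴾ_ (lookup pos v) nothing

module _ {n : ℕ} (pos : Position n) {v : Fin n} {X : Player} where

  Free-pick⁻ : ∀ {u} → Free (pick pos v X) u → u ≢ v × Free pos u
  Free-pick⁻ {u} fu with u ≟ v
  ... | no u≢v   = u≢v , trans (sym (lookup∘update′ u≢v pos (just X))) fu
  ... | yes refl with () ← trans (sym (lookup∘update v pos (just X))) fu

  Free-pick⁺ : ∀ {u} → u ≢ v → Free pos u → Free (pick pos v X) u
  Free-pick⁺ u≢v fu = trans (lookup∘update′ u≢v pos (just X)) fu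

-- Giving vertices to Enforcer also serves to delete them from the graph on the free vertices.
pickAll : ∀ {m n} → Position n → Vec (Fin n) m → Position n
pickAll pos []       = pos
pickAll pos (v ∷ vs) = pickAll (pick pos v enforcer) vs

Free-pickAll⁻ : ∀ {m n} (pos : Position n) (vs : Vec (Fin n) m) {u} →
                Free (pickAll pos vs) u → u ∉ vs × Free pos u
Free-pickAll⁻ pos []       fu = (λ ()) , fu
Free-pickAll⁻ pos (v ∷ vs) fu with u∉vs , fu′ ← Free-pickAll⁻ _ vs fu
                              with u≢v , fu″ ← Free-pick⁻ pos fu′ =
  (λ { (here u≡v) → u≢v u≡v ; (there u∈vs) → u∉vs u∈vs }) , fu″

Free-pickAll⁺ : ∀ {m n} (pos : Position n) (vs : Vec (Fin n) m) {u} →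
                u ∉ vs → Free pos u → Free (pickAll pos vs) u
Free-pickAll⁺ pos []       u∉ fu = fu
Free-pickAll⁺ pos (v ∷ vs) u∉ fu =
  Free-pickAll⁺ _ vs (u∉ ∘ there) (Free-pick⁺ pos (u∉ ∘ here) fu)

#free : ∀ {n} → Position n → ℕ
#free []              = 0
#free (nothing ∷ pos) = suc (#free pos)
#free (just _  ∷ pos) = #free pos

#free-initial : ∀ n → #free (initial n) ≡ n
#free-initial zero    = refl
#free-initial (suc n) = cong suc (#free-initial n)

Free-initial : ∀ {n} (v : Fin n) → Free (initial n) v
Free-initial v = lookup-replicate v nothing

#free-pick : ∀ {n} (pos : Position n) {v X} → Free pos v → #free pos ≡ suc (#free (pick pos v X))
#free-pick (nothing ∷ pos) {zero}  fv = refl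
#free-pick (nothing ∷ pos) {suc v} fv = cong suc (#free-pick pos {v} fv)
#free-pick (just _  ∷ pos) {suc v} fv = #free-pick pos {v} fv

#free-pick′ : ∀ {n} (pos : Position n) {v X k} → Free pos v → #free pos ≡ suc k → #free (pick pos v X) ≡ k
#free-pick′ pos fv e = suc-injective (trans (sym (#free-pick pos fv)) e)

#free≡0⇒Full : ∀ {n} (pos : Position n) → #free pos ≡ 0 → Full pos
#free≡0⇒Full pos e v fv with () ← trans (sym e) (#free-pick pos {v} {enforcer} fv)

#free≡suc⇒Free : ∀ {n} (pos : Position n) {k} → #free pos ≡ suc k → ∃ (Free pos)
#free≡suc⇒Free (nothing ∷ pos) e = zero , refl
#free≡suc⇒Free (just _  ∷ pos) e with v , fv ← #free≡suc⇒Free pos e = suc v , fv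

#free-pickAll : ∀ {m n} (pos : Position n) {vs : Vec (Fin n) m} →
                Unique vs → (∀ {v} → v ∈ vs → Free pos v) →
                #free pos ≡ m + #free (pickAll pos vs)
#free-pickAll pos {[]}     []         fvs = refl
#free-pickAll pos {v ∷ vs} (v∉ ∷ vs!) fvs =
  trans (#free-pick pos (fvs (here refl)))
        (cong suc (#free-pickAll _ vs! λ {u} u∈ →
          Free-pick⁺ pos (λ u≡v → All.lookup v∉ u∈ (sym u≡v)) (fvs (there u∈))))

-- Parity and the last player.

parity : ∀ n → (∃[ k ] n ≡ k * 2) ⊎ (∃[ k ] n ≡ suc (k * 2))
parity zero    = inj₁ (0 , refl)
parity (suc n) with parity n
... | inj₁ (k , refl) = inj₂ (k , refl)
... | inj₂ (k , refl) = inj₁ (suc k , refl)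

opponent-involutive : ∀ X → opponent (opponent X) ≡ X
opponent-involutive avoider  = refl
opponent-involutive enforcer = refl

lastPlayer-suc : ∀ n X → lastPlayer (suc n) X ≡ lastPlayer n (opponent X)
lastPlayer-suc zero          X = sym (opponent-involutive X)
lastPlayer-suc (suc zero)    X = refl
lastPlayer-suc (suc (suc n)) X = lastPlayer-suc n X

lastPlayer-+even : ∀ m k X → lastPlayer (m + k * 2) X ≡ lastPlayer m X
lastPlayer-+even m zero    X = cong (λ i → lastPlayer i X) (+-comm m 0)
lastPlayer-+even m (suc k) X =
  trans (cong (λ i → lastPlayer i X) (trans (+-suc m _) (cong suc (+-suc m _)))) (lastPlayer-+even m k X)

lastPlayer-+odd : ∀ m k X → lastPlayer (m + suc (k * 2)) X ≡ lastPlayer m (opponent X)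
lastPlayer-+odd m k X =
  trans (cong (λ i → lastPlayer i X) (+-suc m _))
        (trans (lastPlayer-suc (m + k * 2) X) (lastPlayer-+even m k (opponent X)))

lastPlayer-even : ∀ k {n} → n ≡ k * 2 → ∀ X → lastPlayer n X ≡ opponent X
lastPlayer-even k refl X = lastPlayer-+even 0 k X

lastPlayer-odd : ∀ k {n} → n ≡ suc (k * 2) → ∀ X → lastPlayer n X ≡ X
lastPlayer-odd k refl X = trans (lastPlayer-+odd 0 k X) (opponent-involutive X)

opponent-injective : ∀ {X Y} → opponent X ≡ opponent Y → X ≡ Y
opponent-injective {X} {Y} e =
  trans (sym (opponent-involutive X)) (trans (cong opponent e) (opponent-involutive Y))

lastPlayer-injective : ∀ n {X Y} → lastPlayer n X ≡ lastPlayer n Y → X ≡ Y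
lastPlayer-injective n e with n % 2 ≡ᵇ 1
... | true  = e
... | false = opponent-injective e

-- Isolated vertices and centres among the free vertices.

module _ {n : ℕ} (G : Graph (Fin n)) where

  -- Picked vertices remain as isolated ones, so that the vertex type stays fixed throughout the
  -- game.
  induced : Position n → Graph (Fin n)
  induced pos .Adj u v = Adj G u v × Free pos u × Free pos v
  induced pos .adj? u v = adj? G u v ×-dec (free? pos u ×-dec free? pos v)
  induced pos .symm (uv , fu , fv) = symm G uv , fv , fu
  induced pos .irrefl u≡v (uv , _) = irrefl G u≡v uv

  induced-PatternFree : ∀ pos → PatternFree G → PatternFree (induced pos)
  induced-PatternFree pos free = free ∘ λ
    { (inj₁ h)        → inj₁ (⊑-trans 2P₃ (induced pos) G h inc)
    ; (inj₂ (inj₁ h)) → inj₂ (inj₁ (⊑-trans C₄ (induced pos) G h inc))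
    ; (inj₂ (inj₂ h)) → inj₂ (inj₂ (⊑-trans 3-sunlet (induced pos) G h inc)) }
    where
    inc : induced pos ⊑ G
    inc = id , id , proj₁

  -- Equivalently, every free vertex has at most one free neighbour.
  Matching : Position n → Set
  Matching pos = ¬ Path₃ (induced pos)

  Isolated : Position n → Fin n → Set
  Isolated pos u = Free pos u × (∀ {v} → Free pos v → ¬ Adj G u v)

  Matching-mono : ∀ pos pos′ → (∀ {v} → Free pos′ v → Free pos v) → Matching pos → Matching pos′
  Matching-mono pos pos′ ⊆ m (path₃ (pq , fp , fq) (qr , _ , fr) p≢r) =
    m (path₃ (pq , ⊆ fp , ⊆ fq) (qr , ⊆ fq , ⊆ fr) p≢r)

  Matching-pick : ∀ pos v X → Matching pos → Matching (pick pos v X)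
  Matching-pick pos v X = Matching-mono pos (pick pos v X) (proj₂ ∘ Free-pick⁻ pos)

  -- Take any free vertex. If it has a free neighbour, delete both, which preserves oddness. A
  -- vertex isolated in the remainder is not adjacent to the deleted pair either, since that would
  -- create a path on three vertices.
  odd-matching⇒isolated : ∀ k pos → #free pos ≡ suc (k * 2) → Matching pos → ∃ (Isolated pos)
  odd-matching⇒isolated k pos e m
    with v , fv ← #free≡suc⇒Free pos e
    with any? (λ u → free? pos u ×-dec adj? G v u)
  ... | no ¬u = v , fv , λ fu vu → ¬u (_ , fu , vu)
  odd-matching⇒isolated zero pos e m | yes (u , fu , vu) =
    contradiction (Free-pick⁺ pos (≢-sym (adj⇒≢ G vu)) fu)
                  (#free≡0⇒Full (pick pos v enforcer) (#free-pick′ pos fv e) u)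
  odd-matching⇒isolated (suc k) pos e m | yes (u , fu , vu)
    with w , fw , iso ← odd-matching⇒isolated k (pick (pick pos v enforcer) u enforcer)
           (#free-pick′ (pick pos v enforcer) (Free-pick⁺ pos (≢-sym (adj⇒≢ G vu)) fu) (#free-pick′ pos fv e))
           (Matching-pick (pick pos v enforcer) u enforcer (Matching-pick pos v enforcer m))
    with w≢u , fw′ ← Free-pick⁻ (pick pos v enforcer) fw
    with w≢v , fw″ ← Free-pick⁻ pos fw′ = w , fw″ , isolated
    where
    isolated : ∀ {t} → Free pos t → ¬ Adj G w t
    isolated {t} ft wt with t ≟ u | t ≟ v
    ... | yes refl | _        = m (path₃ (vu , fv , fu) (symm G wt , fu , fw″) (≢-sym w≢v))
    ... | _        | yes refl = m (path₃ (symm G vu , fu , fv) (symm G wt , fv , fw″) (≢-sym w≢u))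
    ... | no t≢u   | no t≢v   = iso (Free-pick⁺ (pick pos v enforcer) t≢u (Free-pick⁺ pos t≢v ft)) wt

path₃? : ∀ {n} (G : Graph (Fin n)) → Dec (Path₃ G)
path₃? G = map′ (λ (p , q , r , pq , qr , p≢r) → path₃ pq qr p≢r)
                (λ (path₃ pq qr p≢r) → _ , _ , _ , pq , qr , p≢r)
                (any? λ p → any? λ q → any? λ r → adj? G p q ×-dec (adj? G q r ×-dec ¬? (p ≟ r)))

module _ {n : ℕ} (G : Graph (Fin n)) (free : PatternFree G) where

  -- Giving `c` to Enforcer deletes it, so the condition is that `c` lies on every free path on
  -- three vertices.
  FreeCentre : Position n → Fin n → Set
  FreeCentre pos c = Free pos c × Matching G (pick pos c enforcer)

  -- Removing the five shore vertices from an even number leaves an odd matching, which has an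
  -- isolated vertex. It stays isolated in `pos`, because no edge between free vertices leaves the
  -- shore.
  island⇒isolated : ∀ k pos → #free pos ≡ suc k * 2 → Island (induced G pos) → ∃ (Isolated G pos)
  island⇒isolated k pos e I = isolated
    where
    open Island I

    sea = pickAll pos shore

    odd-sea : ∀ k → #free pos ≡ suc k * 2 → ∃[ j ] #free sea ≡ suc (j * 2)
    -- Shore vertices are free: `inner` puts each on an edge of `induced pos`.
    odd-sea k e with trans (sym (#free-pickAll pos shore! (proj₁ ∘ proj₂ ∘ proj₂ ∘ inner))) e
    -- An even number that is at least five has the form `6 + j * 2`; removing five leaves
    -- `suc (j * 2)`.
    odd-sea (suc (suc j)) _ | e′ = j , +-cancelˡ-≡ 5 _ _ e′

    matching : Matching G sea
    matching (path₃ (pq , fp , fq) (qr , _ , fr) p≢r)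
      with p∉ , fp′ ← Free-pickAll⁻ pos shore fp
         | q∉ , fq′ ← Free-pickAll⁻ pos shore fq
         | r∉ , fr′ ← Free-pickAll⁻ pos shore fr
      with meets (path₃ (pq , fp′ , fq′) (qr , fq′ , fr′) p≢r)
    ... | _ , p∈ , here refl                 = p∉ p∈
    ... | _ , q∈ , there (here refl)         = q∉ q∈
    ... | _ , r∈ , there (there (here refl)) = r∉ r∈

    isolated : ∃ (Isolated G pos)
    isolated
      with j , e′ ← odd-sea k e
      with w , fw , iso ← odd-matching⇒isolated G j sea e′ matching
      with w∉ , fw′ ← Free-pickAll⁻ pos shore fw = w , fw′ , λ {t} ft wt → iso-in-pos t ft wt
      where
      iso-in-pos : ∀ t → Free pos t → ¬ Adj G w t
      iso-in-pos t ft wt with t ∈? shore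
      ... | yes t∈ = w∉ (closed t∈ (symm G wt , ft , fw′))
      ... | no t∉  = iso (Free-pickAll⁺ pos shore t∉ ft) wt

  -- Without a centre, every free vertex is avoided by some free path on three vertices, which is
  -- the hypothesis under which an island exists.
  even⇒isolated⊎centre : ∀ k pos → #free pos ≡ suc k * 2 → ∃ (Isolated G pos) ⊎ ∃ (FreeCentre pos)
  even⇒isolated⊎centre k pos e
    with any? (λ c → free? pos c ×-dec ¬? (path₃? (induced G (pick pos c enforcer))))
  ... | yes centre = inj₂ centre
  ... | no ¬centre = inj₁ (island⇒isolated k pos e
    (island (induced G pos) (induced-PatternFree G pos free) (avoiding ∘ proj₁ ∘ proj₂)
            -- The initial path required by `island` is one that avoids an arbitrary free vertex.
            (proj₁ (avoiding (proj₂ (#free≡suc⇒Free pos e))))))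
    where
    avoiding : ∀ {c} → Free pos c → ∃[ π ] Avoids (induced G pos) π c
    avoiding {c} fc = from-path (decidable-stable (path₃? _) (λ m → ¬centre (c , fc , m)))
      where
      from-path : Path₃ (induced G (pick pos c enforcer)) → ∃[ π ] Avoids (induced G pos) π c
      from-path (path₃ (pq , fp , fq) (qr , _ , fr) p≢r)
        with p≢c , fp′ ← Free-pick⁻ pos fp | q≢c , fq′ ← Free-pick⁻ pos fq | r≢c , fr′ ← Free-pick⁻ pos fr =
        path₃ (pq , fp′ , fq′) (qr , fq′ , fr′) p≢r , λ
          { (here c≡p)                 → p≢c (sym c≡p)
          ; (there (here c≡q))         → q≢c (sym c≡q)
          ; (there (there (here c≡r))) → r≢c (sym c≡r) }

-- Strategies for Avoider.

module _ {n : ℕ} (G : Graph (Fin n)) where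

  AvoiderWins : Player → Position n → Set
  AvoiderWins = WinningStrategy G avoider

  -- This invariant is stronger than the absence of an Avoider edge: no vertex already held by
  -- Avoider can become part of one later.
  Safe : Position n → Set
  Safe pos = ∀ {u v} → lookup pos u ≡ just avoider → Adj G u v → lookup pos v ≡ just enforcer

  Safe-initial : Safe (initial n)
  Safe-initial {u} uA with () ← trans (sym (Free-initial u)) uA

  Safe-pick-enforcer : ∀ pos v → Safe pos → Safe (pick pos v enforcer)
  Safe-pick-enforcer pos v safe {u} {w} uA uw with u ≟ v | w ≟ v
  ... | yes refl | _        with () ← trans (sym (lookup∘update v pos (just enforcer))) uA
  Safe-pick-enforcer pos v safe {u} {w} uA uw
      | _        | yes refl = lookup∘update v pos (just enforcer)
  ... | no u≢v   | no w≢v   =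
    trans (lookup∘update′ w≢v pos _) (safe (trans (sym (lookup∘update′ u≢v pos _)) uA) uw)

  -- No neighbour of `v` is free, and none belongs to Avoider, since safety would then have given
  -- `v` to Enforcer.
  Safe-pick-isolated : ∀ pos v → Isolated G pos v → Safe pos → Safe (pick pos v avoider)
  Safe-pick-isolated pos v (fv , iso) safe {u} {w} uA uw with u ≟ v
  ... | no u≢v = trans (lookup∘update′ w≢v pos _) wE
    where
    wE : lookup pos w ≡ just enforcer
    wE = safe (trans (sym (lookup∘update′ u≢v pos _)) uA) uw

    w≢v : w ≢ v
    w≢v refl with () ← trans (sym wE) fv
  ... | yes refl = trans (lookup∘update′ (≢-sym (adj⇒≢ G uw)) pos _) (taken (lookup pos w) refl)
    where
    taken : ∀ x → lookup pos w ≡ x → lookup pos w ≡ just enforcer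
    taken nothing         wF = contradiction uw (iso wF)
    taken (just enforcer) wE = wE
    taken (just avoider)  wA with () ← trans (sym fv) (safe wA (symm G uw))

  safe-finish : ∀ turn pos → #free pos ≡ 0 → Safe pos → AvoiderWins turn pos
  safe-finish turn pos e safe = finish (#free≡0⇒Full pos e) won
    where
    won : ¬ AvoiderTookEdge G pos
    won (u , v , uv , uA , vA) with () ← trans (sym vA) (safe uA uv)

  -- When Avoider is last, the number of free vertices is odd at each of Avoider's turns, so the
  -- matching always offers an isolated vertex.
  matching-last-E : ∀ k pos → #free pos ≡ k * 2 → Safe pos → Matching G pos → AvoiderWins enforcer pos
  matching-last-A : ∀ k pos → #free pos ≡ suc (k * 2) → Safe pos → Matching G pos → AvoiderWins avoider pos

  matching-last-E zero    pos e safe m = safe-finish enforcer pos e safe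
  matching-last-E (suc k) pos e safe m = reply (λ ()) (#free≡suc⇒Free pos e) λ v fv →
    matching-last-A k (pick pos v enforcer) (#free-pick′ pos fv e)
      (Safe-pick-enforcer pos v safe) (Matching-pick G pos v enforcer m)

  matching-last-A k pos e safe m with v , iso@(fv , _) ← odd-matching⇒isolated G k pos e m =
    play refl v fv (matching-last-E k (pick pos v avoider) (#free-pick′ pos fv e)
      (Safe-pick-isolated pos v iso safe) (Matching-pick G pos v avoider m))

  module _ (free : PatternFree G) where

    -- While the centre c is free, Avoider plays as if Enforcer already held it.
    centre-E : ∀ k pos c → #free pos ≡ suc (k * 2) → Free pos c →
               Safe (pick pos c enforcer) → Matching G (pick pos c enforcer) → AvoiderWins enforcer pos
    centre-A : ∀ k pos c → #free pos ≡ suc k * 2 → Free pos c →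
               Safe (pick pos c enforcer) → Matching G (pick pos c enforcer) → AvoiderWins avoider pos
    -- At each of Avoider's turns the number of free vertices is even. While any remain, Avoider
    -- either takes an isolated vertex, preserving safety, or switches to the strategy around a
    -- centre.
    second-to-last-E : ∀ k pos → #free pos ≡ suc (k * 2) → Safe pos → AvoiderWins enforcer pos
    second-to-last-A : ∀ k pos → #free pos ≡ k * 2 → Safe pos → AvoiderWins avoider pos

    centre-E k pos c e fc safe m = reply (λ ()) (c , fc) respond
      where
      elsewhere : ∀ k → #free pos ≡ suc (k * 2) → ∀ v → Free pos v → v ≢ c →
                  AvoiderWins avoider (pick pos v enforcer)
      elsewhere zero e v fv v≢c =
        contradiction (Free-pick⁺ pos (≢-sym v≢c) fc)
                      (#free≡0⇒Full (pick pos v enforcer) (#free-pick′ pos fv e) c)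
      elsewhere (suc k) e v fv v≢c = centre-A k (pick pos v enforcer) c (#free-pick′ pos fv e)
        (Free-pick⁺ pos (≢-sym v≢c) fc)
        (subst Safe swapped (Safe-pick-enforcer (pick pos c enforcer) v safe))
        (subst (Matching G) swapped (Matching-pick G (pick pos c enforcer) v enforcer m))
        where
        -- Picks at distinct vertices commute, so the hypotheses about the imagined position, with
        -- `c` already Enforcer's, carry over the actual move at `v`.
        swapped = []≔-commutes pos c v (≢-sym v≢c)

      respond : ∀ v → Free pos v → AvoiderWins avoider (pick pos v enforcer)
      respond v fv with v ≟ c
      -- Enforcer takes the centre, so the imagined position has become the actual one.
      ... | yes refl = second-to-last-A k (pick pos c enforcer) (#free-pick′ pos fc e) safe
      ... | no v≢c   = elsewhere k e v fv v≢c

    centre-A k pos c e fc safe m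
      -- Setting `c` aside leaves `suc (k * 2)` free vertices, an odd matching.
      with v , iso@(fv , _) ← odd-matching⇒isolated G k (pick pos c enforcer) (#free-pick′ pos fc e) m
      with v≢c , fv′ ← Free-pick⁻ pos fv =
      play refl v fv′ (centre-E k (pick pos v avoider) c (#free-pick′ pos fv′ e)
        (Free-pick⁺ pos (≢-sym v≢c) fc)
        (subst Safe swapped (Safe-pick-isolated (pick pos c enforcer) v iso safe))
        (subst (Matching G) swapped (Matching-pick G (pick pos c enforcer) v avoider m)))
      where
      swapped = []≔-commutes pos c v (≢-sym v≢c)

    second-to-last-E k pos e safe = reply (λ ()) (#free≡suc⇒Free pos e) λ v fv →
      second-to-last-A k (pick pos v enforcer) (#free-pick′ pos fv e) (Safe-pick-enforcer pos v safe)

    second-to-last-A zero    pos e safe = safe-finish avoider pos e safe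
    second-to-last-A (suc k) pos e safe with even⇒isolated⊎centre G free k pos e
    ... | inj₁ (v , iso@(fv , _)) =
      play refl v fv (second-to-last-E k (pick pos v avoider) (#free-pick′ pos fv e)
        (Safe-pick-isolated pos v iso safe))
    ... | inj₂ (c , fc , m) =
      centre-A k pos c e fc (Safe-pick-enforcer pos c safe) m

  avoiderWinsAsLast : ¬ (P₃ ⊑ G) → WinsAsLast avoider G
  avoiderWinsAsLast ¬P₃ first last = byParity first last (parity n)
    where
    matching : Matching G (initial n)
    matching (path₃ {p} {q} {r} (pq , _) (qr , _) p≢r) =
      ¬P₃ (lookup vs , lookup-injective vs! _ _ , P₃-hom G (lookup vs) pq qr)
      where
      vs = p ∷ q ∷ r ∷ []

      vs! : Unique vs
      vs! = (adj⇒≢ G pq ∷ p≢r ∷ []) ∷ (adj⇒≢ G qr ∷ []) ∷ [] ∷ []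

    byParity : ∀ first → lastPlayer n first ≡ avoider →
               (∃[ k ] n ≡ k * 2) ⊎ (∃[ k ] n ≡ suc (k * 2)) → AvoiderWins first (initial n)
    byParity avoider last (inj₁ (k , n≡))
      with () ← trans (sym (lastPlayer-even k n≡ avoider)) last
    byParity enforcer last (inj₁ (k , n≡)) =
      matching-last-E k (initial n) (trans (#free-initial n) n≡) Safe-initial matching
    byParity avoider last (inj₂ (k , n≡)) =
      matching-last-A k (initial n) (trans (#free-initial n) n≡) Safe-initial matching
    byParity enforcer last (inj₂ (k , n≡))
      with () ← trans (sym (lastPlayer-odd k n≡ enforcer)) last

  avoiderWinsAsSecondToLast : PatternFree G → WinsAsSecondToLast avoider G
  avoiderWinsAsSecondToLast free first second-to-last = byParity first second-to-last (parity n)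
    where
    byParity : ∀ first → secondToLastPlayer n first ≡ avoider →
               (∃[ k ] n ≡ k * 2) ⊎ (∃[ k ] n ≡ suc (k * 2)) → AvoiderWins first (initial n)
    byParity avoider _ (inj₁ (k , n≡)) =
      second-to-last-A free k (initial n) (trans (#free-initial n) n≡) Safe-initial
    byParity enforcer stl (inj₁ (k , n≡))
      with () ← trans (cong opponent (sym (lastPlayer-even k n≡ enforcer))) stl
    byParity avoider stl (inj₂ (k , n≡))
      with () ← trans (cong opponent (sym (lastPlayer-odd k n≡ avoider))) stl
    byParity enforcer _ (inj₂ (k , n≡)) =
      second-to-last-E free k (initial n) (trans (#free-initial n) n≡) Safe-initial

-- Enforcer on the small patterns by exhaustive search.

module _ {n : ℕ} (G : Graph (Fin n)) where

  -- Owners never change, so the edge survives all later picks. The remaining moves are still played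
  -- out, arbitrarily, because only full positions are evaluated.
  took-edge⇒wins : ∀ k turn pos → #free pos ≡ k → AvoiderTookEdge G pos → WinningStrategy G enforcer turn pos
  took-edge⇒wins k turn pos e took@(u , v , uv , uA , vA) = wins k turn e
    where
    stays : ∀ {w X} → Free pos w → ∀ {u} → lookup pos u ≡ just avoider →
            lookup (pick pos w X) u ≡ just avoider
    stays {w} fw {u} uA = trans (lookup∘update′ u≢w pos _) uA
      where
      u≢w : u ≢ w
      u≢w refl with () ← trans (sym fw) uA

    after : ∀ {w X} → Free pos w → AvoiderTookEdge G (pick pos w X)
    after fw = u , v , uv , stays fw uA , stays fw vA

    wins : ∀ k turn → #free pos ≡ k → WinningStrategy G enforcer turn pos
    wins zero    _        e = finish (#free≡0⇒Full pos e) took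
    wins (suc k) avoider  e = reply (λ ()) (#free≡suc⇒Free pos e) λ w fw →
      took-edge⇒wins k enforcer (pick pos w avoider) (#free-pick′ pos fw e) (after fw)
    wins (suc k) enforcer e with w , fw ← #free≡suc⇒Free pos e =
      play refl w fw (took-edge⇒wins k avoider (pick pos w enforcer) (#free-pick′ pos fw e) (after fw))

  tookEdge? : ∀ pos → Dec (AvoiderTookEdge G pos)
  tookEdge? pos = any? λ u → any? λ v →
    adj? G u v ×-dec (owned? u ×-dec owned? v)
    where
    owned? : ∀ u → Dec (lookup pos u ≡ just avoider)
    owned? u = ≡-dec _≟ᴾ_ (lookup pos u) (just avoider)

  wonBy? : ∀ X pos → Dec (WonBy G X pos)
  wonBy? avoider  pos = ¬? (tookEdge? pos)
  wonBy? enforcer pos = tookEdge? pos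

  Move : Player → Player → Position n → Fin n → Set
  Move X turn pos v = Σ (Free pos v) λ _ → WinningStrategy G X (opponent turn) (pick pos v turn)

  -- A search of the game tree, made structurally recursive by the number `k` of free vertices.
  winningStrategy? : ∀ X k turn pos → #free pos ≡ k → Dec (WinningStrategy G X turn pos)
  winningStrategy? X zero turn pos e =
    map′ (finish full) (λ { (finish _ won)        → won
                          ; (play _ v fv _)       → contradiction fv (full v)
                          ; (reply _ (v , fv) _)  → contradiction fv (full v) })
         (wonBy? X pos)
    where
    full = #free≡0⇒Full pos e
  winningStrategy? X (suc k) turn pos e with turn ≟ᴾ X
  ... | yes turn≡X =
    map′ (λ (v , fv , s) → play turn≡X v fv s)
         (λ { (finish full _)        → let v , fv = some in contradiction fv (full v)
            ; (play _ v fv s)        → v , fv , s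
            ; (reply turn≢X _ _)     → contradiction turn≡X turn≢X })
         (any? move?)
    where
    some = #free≡suc⇒Free pos e

    move? : ∀ v → Dec (Move X turn pos v)
    move? v with free? pos v
    ... | yes fv = map′ (fv ,_) proj₂
                     (winningStrategy? X k (opponent turn) (pick pos v turn) (#free-pick′ pos fv e))
    ... | no ¬fv = no (¬fv ∘ proj₁)
  ... | no turn≢X =
    map′ (reply turn≢X some)
         (λ { (finish full _)        → let v , fv = some in contradiction fv (full v)
            ; (play turn≡X _ _ _)    → contradiction turn≡X turn≢X
            ; (reply _ _ s)          → s })
         (all? answer?)
    where
    some = #free≡suc⇒Free pos e

    answer? : ∀ v → Dec (Free pos v → WinningStrategy G X (opponent turn) (pick pos v turn))
    answer? v with free? pos v
    ... | yes fv = map′ (λ s _ → s) (λ f → f fv)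
                     (winningStrategy? X k (opponent turn) (pick pos v turn) (#free-pick′ pos fv e))
    ... | no ¬fv = yes λ fv → contradiction fv ¬fv

-- The game is played on `Fin n`; pulling back along `splitAt` renumbers the patterns whose vertices
-- form a sum type.
pullback : ∀ {U V : Set} → (U → V) → Graph V → Graph U
pullback f G .Adj u v        = Adj G (f u) (f v)
pullback f G .adj? u v       = adj? G (f u) (f v)
pullback f G .symm           = symm G
pullback f G .irrefl u≡v     = irrefl G (cong f u≡v)

splitAt-injective : ∀ m {k} → Injective {A = Fin (m + k)} _≡_ _≡_ (splitAt m {k})
splitAt-injective m {k} = Injection.injective (Inverse⇒Injection (+↔⊎ {m} {k}))

pullback-⊑ : ∀ {m k} (H : Graph (Fin m ⊎ Fin k)) → pullback (splitAt m) H ⊑ H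
pullback-⊑ {m} H = splitAt m , splitAt-injective m , id

EnforcerWinsSecond : ∀ {m} → Graph (Fin m) → Set
EnforcerWinsSecond {m} H = WinningStrategy H enforcer avoider (initial m)

enforcerWinsSecond? : ∀ {m} (H : Graph (Fin m)) → Dec (EnforcerWinsSecond H)
enforcerWinsSecond? {m} H = winningStrategy? H enforcer m avoider (initial m) (#free-initial m)

-- With three vertices, Enforcer moving second is second-to-last. The other three patterns have an
-- even order, so there Enforcer moving second is last.
P₃-second : EnforcerWinsSecond P₃
P₃-second = from-yes (enforcerWinsSecond? P₃)

C₄-second : EnforcerWinsSecond C₄
C₄-second = from-yes (enforcerWinsSecond? C₄)

2P₃-second : EnforcerWinsSecond (pullback (splitAt 3) 2P₃)
2P₃-second = from-yes (enforcerWinsSecond? (pullback (splitAt 3) 2P₃))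

3-sunlet-second : EnforcerWinsSecond (pullback (splitAt 3) 3-sunlet)
3-sunlet-second = from-yes (enforcerWinsSecond? (pullback (splitAt 3) 3-sunlet))

∈-tabulate⁻ : ∀ {m n} {f : Fin m → Fin n} {v} → v ∈ tabulate f → ∃[ i ] v ≡ f i
∈-tabulate⁻ {suc m} (here v≡)  = zero , v≡
∈-tabulate⁻ {suc m} (there v∈) with i , v≡ ← ∈-tabulate⁻ v∈ = suc i , v≡

-- Transfer of Enforcer's strategy from a subgraph.

module _ {m n : ℕ} (H : Graph (Fin m)) (G : Graph (Fin n)) (H⊑G : H ⊑ G) where

  private
    f = proj₁ H⊑G

    f-injective : ∀ {i j} → f i ≡ f j → i ≡ j
    f-injective = proj₁ (proj₂ H⊑G)

    OutsideImage : Fin n → Set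
    OutsideImage v = ∀ i → v ≢ f i

  -- Only the set of free vertices of rest matters: the free vertices outside the copy of H.
  record Extends (onH : Position m) (rest onG : Position n) : Set where
    field
      agree    : ∀ i → lookup onG (f i) ≡ lookup onH i
      outside⁻ : ∀ {v} → Free rest v → Free onG v × OutsideImage v
      outside⁺ : ∀ {v} → Free onG v → OutsideImage v → Free rest v

  open Extends

  pick-inside : ∀ {onH rest onG} i X → Extends onH rest onG →
                Extends (pick onH i X) rest (pick onG (f i) X)
  pick-inside {onH} {rest} {onG} i X ext .agree j with j ≟ i
  ... | yes refl = trans (lookup∘update (f i) onG _) (sym (lookup∘update i onH _))
  ... | no j≢i   = trans (lookup∘update′ (j≢i ∘ f-injective) onG _)
                     (trans (agree ext j) (sym (lookup∘update′ j≢i onH _)))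
  pick-inside {onG = onG} i X ext .outside⁻ fv with fv′ , out ← outside⁻ ext fv =
    Free-pick⁺ onG (out i) fv′ , out
  pick-inside {onG = onG} i X ext .outside⁺ fv out = outside⁺ ext (proj₂ (Free-pick⁻ onG fv)) out

  pick-outside : ∀ {onH rest onG} v X Y → OutsideImage v → Extends onH rest onG →
                 Extends onH (pick rest v Y) (pick onG v X)
  pick-outside {onG = onG} v X Y out ext .agree i =
    trans (lookup∘update′ (≢-sym (out i)) onG _) (agree ext i)
  pick-outside {rest = rest} {onG} v X Y out ext .outside⁻ fu
    with u≢v , fu′ ← Free-pick⁻ rest fu with fu″ , out′ ← outside⁻ ext fu′ = Free-pick⁺ onG u≢v fu″ , out′
  pick-outside {rest = rest} {onG} v X Y out ext .outside⁺ fu out′ with u≢v , fu′ ← Free-pick⁻ onG fu =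
    Free-pick⁺ rest u≢v (outside⁺ ext fu′ out′)

  private
    EnforcerWins : Player → Position n → Set
    EnforcerWins = WinningStrategy G enforcer

  -- The copy of `H` can be full while outside vertices are still free, so the game on `G` may have
  -- to be continued.
  lift-won : ∀ {turn onH rest onG} → AvoiderTookEdge H onH → Extends onH rest onG → EnforcerWins turn onG
  lift-won {turn} {onG = onG} (i , j , ij , iA , jA) ext =
    took-edge⇒wins G (#free onG) turn onG refl
      (f i , f j , proj₂ (proj₂ H⊑G) ij , trans (agree ext i) iA , trans (agree ext j) jA)

  -- Enforcer answers a pick in the copy of `H` by the strategy on `H`, and a pick outside by
  -- another pick outside. The latter is possible because the number of free outside vertices is
  -- even before each of Avoider's turns.
  lift-avoider  : ∀ {onH} → WinningStrategy H enforcer avoider onH →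
                  ∀ k rest onG → #free rest ≡ k * 2 → Extends onH rest onG → EnforcerWins avoider onG
  lift-enforcer : ∀ {onH} → WinningStrategy H enforcer enforcer onH →
                  ∀ k rest onG → #free rest ≡ k * 2 → Extends onH rest onG → EnforcerWins enforcer onG

  lift-avoider (finish _ won) k rest onG e ext = lift-won won ext
  lift-avoider σ@(reply _ (i , fi) s) k rest onG e ext =
    reply (λ ()) (f i , trans (agree ext i) fi) answer
    where
    elsewhere : ∀ k → #free rest ≡ k * 2 → ∀ v → Free onG v → OutsideImage v →
                EnforcerWins enforcer (pick onG v avoider)
    elsewhere zero    e v fv out = contradiction (outside⁺ ext fv out) (#free≡0⇒Full rest e v)
    elsewhere (suc k) e v fv out = elsewhere′ (#free≡suc⇒Free rest₁ e₁)
      where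
      rest₁ = pick rest v avoider
      onG₁  = pick onG v avoider

      e₁ : #free rest₁ ≡ suc (k * 2)
      e₁ = #free-pick′ rest (outside⁺ ext fv out) e

      ext₁ : Extends _ rest₁ onG₁
      ext₁ = pick-outside v avoider avoider out ext

      elsewhere′ : ∃ (Free rest₁) → EnforcerWins enforcer onG₁
      elsewhere′ (u , fu) with fu′ , out′ ← outside⁻ ext₁ fu =
        -- Nothing happened inside the copy, so the same strategy `σ` remains in force.
        play refl u fu′ (lift-avoider σ k (pick rest₁ u enforcer) (pick onG₁ u enforcer)
          (#free-pick′ rest₁ fu e₁) (pick-outside u enforcer enforcer out′ ext₁))

    answer : ∀ v → Free onG v → EnforcerWins enforcer (pick onG v avoider)
    answer v fv with any? (λ i → v ≟ f i)
    ... | no ¬i        = elsewhere k e v fv λ i v≡ → ¬i (i , v≡)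
    ... | yes (i , refl) =
      lift-enforcer (s i (trans (sym (agree ext i)) fv)) k rest (pick onG (f i) avoider) e (pick-inside i avoider ext)

  lift-enforcer (finish _ won) k rest onG e ext = lift-won won ext
  lift-enforcer (play _ i fi s) k rest onG e ext =
    play refl (f i) (trans (agree ext i) fi)
      (lift-avoider s k rest (pick onG (f i) enforcer) e (pick-inside i enforcer ext))
  lift-enforcer (reply e≢e _ _) k rest onG e ext = contradiction refl e≢e

  -- The last player is to be the same as on `H` with Avoider starting. Hence Avoider starts on `G`
  -- if the number of outside vertices is even. If it is odd, Enforcer starts and spends this move
  -- outside, which leaves an even number.
  enforcerWins : EnforcerWinsSecond H →
                 ∀ first → lastPlayer n first ≡ lastPlayer m avoider → EnforcerWins first (initial n)
  enforcerWins σ first last = byParity first (parity (#free rest)) last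
    where
    -- Deleting the image of `f` leaves exactly the outside vertices free.
    rest = pickAll (initial n) (tabulate f)

    n≡ : n ≡ m + #free rest
    n≡ = trans (sym (#free-initial n))
               (#free-pickAll (initial n) (tabulate⁺ f-injective) (λ {v} _ → Free-initial v))

    ext : Extends (initial m) rest (initial n)
    ext .agree i         = trans (Free-initial (f i)) (sym (Free-initial i))
    ext .outside⁻ {v} fv =
      Free-initial v ,
      λ { i refl → proj₁ (Free-pickAll⁻ (initial n) (tabulate f) fv) (∈-tabulate⁺ f i) }
    ext .outside⁺ {v} fv out =
      Free-pickAll⁺ (initial n) (tabulate f) (λ v∈ → let i , v≡ = ∈-tabulate⁻ v∈ in out i v≡) fv

    byParity : ∀ first → (∃[ k ] #free rest ≡ k * 2) ⊎ (∃[ k ] #free rest ≡ suc (k * 2)) →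
               lastPlayer n first ≡ lastPlayer m avoider → EnforcerWins first (initial n)
    byParity first (inj₁ (k , e)) last
      with refl ← lastPlayer-injective m
             (trans (sym (lastPlayer-+even m k first))
                    (trans (cong (λ i → lastPlayer i first) (sym (trans n≡ (cong (m +_) e)))) last)) =
      lift-avoider σ k rest (initial n) e ext
    byParity enforcer (inj₂ (k , e)) last with v , fv ← #free≡suc⇒Free rest e =
      play refl v (Free-initial v) (lift-avoider σ k (pick rest v enforcer) (pick (initial n) v enforcer)
        (#free-pick′ rest fv e) (pick-outside v enforcer enforcer (proj₂ (outside⁻ ext fv)) ext))
    byParity avoider (inj₂ (k , e)) last
      with () ← lastPlayer-injective m
             (trans (sym (lastPlayer-+odd m k avoider))
                    (trans (cong (λ i → lastPlayer i avoider) (sym (trans n≡ (cong (m +_) e)))) last))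

-- Enforcer's wins and the three outcomes.

module _ {n : ℕ} (G : Graph (Fin n)) where

  enforcerWinsAsSecondToLast : P₃ ⊑ G → WinsAsSecondToLast enforcer G
  enforcerWinsAsSecondToLast P₃⊑G first second-to-last =
    -- Avoider starting on three vertices is also last there, which matches Avoider being last on
    -- `G`.
    enforcerWins P₃ G P₃⊑G P₃-second first (opponent-injective second-to-last)

  enforcerWinsAsLast : (2P₃ ⊑ G) ⊎ (C₄ ⊑ G) ⊎ (3-sunlet ⊑ G) → WinsAsLast enforcer G
  enforcerWinsAsLast (inj₁ 2P₃⊑G) =
    enforcerWins (pullback (splitAt 3) 2P₃) G
      (⊑-trans (pullback (splitAt 3) 2P₃) 2P₃ G (pullback-⊑ 2P₃) 2P₃⊑G) 2P₃-second
  enforcerWinsAsLast (inj₂ (inj₁ C₄⊑G)) = enforcerWins C₄ G C₄⊑G C₄-second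
  enforcerWinsAsLast (inj₂ (inj₂ sunlet⊑G)) =
    enforcerWins (pullback (splitAt 3) 3-sunlet) G
      (⊑-trans (pullback (splitAt 3) 3-sunlet) 3-sunlet G (pullback-⊑ 3-sunlet) sunlet⊑G) 3-sunlet-second

  pattern⇒P₃ : (2P₃ ⊑ G) ⊎ (C₄ ⊑ G) ⊎ (3-sunlet ⊑ G) → P₃ ⊑ G
  pattern⇒P₃ (inj₁ h) =
    ⊑-trans P₃ 2P₃ G (inj₁ , inj₁-injective , id) h
  pattern⇒P₃ (inj₂ (inj₁ h)) =
    ⊑-trans P₃ C₄ G (inject₁ , inject₁-injective , P₃-hom C₄ inject₁ (inj₁ (inj₁ refl)) (inj₁ (inj₁ refl))) h
  pattern⇒P₃ (inj₂ (inj₂ h)) =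
    ⊑-trans P₃ 3-sunlet G (inj₁ , inj₁-injective , inj₁) h

theorem3p2 : ∀ {n : ℕ} (G : Graph (Fin n)) →
    (¬ (P₃ ⊑ G) → o[ G ]= 𝒜)
    × ((2P₃ ⊑ G) ⊎ (C₄ ⊑ G) ⊎ (3-sunlet ⊑ G) → o[ G ]= ℰ)
    × ((P₃ ⊑ G) → ¬ ((2P₃ ⊑ G) ⊎ (C₄ ⊑ G) ⊎ (3-sunlet ⊑ G)) → o[ G ]= 𝒮ℒ)
theorem3p2 G =
    (λ ¬P₃ → avoiderWinsAsLast G ¬P₃ , avoiderWinsAsSecondToLast G (¬P₃ ∘ pattern⇒P₃ G))
  , (λ pattern⊑G → enforcerWinsAsLast G pattern⊑G , enforcerWinsAsSecondToLast G (pattern⇒P₃ G pattern⊑G))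
  , λ { P₃⊑G free avoider  → avoiderWinsAsSecondToLast G free
      ; P₃⊑G free enforcer → enforcerWinsAsSecondToLast G P₃⊑G }
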